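{- Let $k,n_2,n_3\in\mathbb{N}$ with $n_2\ge 2$ and $n_3\ge 2$. If $k\ge 2$, then $P_2\square P_{n_2}\square P_{n_3}$ is equitably $k$-list arborable.
   Context: $P_n$ denotes the path on $n$ vertices and $\square$ the Cartesian product. A $k$-uniform list assignment $L$ for $G$ assigns to each vertex $v$ a set $L(v)$ of exactly $k$ colours; an $L$-colouring is a map $c$ with $c(v)\in L(v)$; it is equitable if every colour class has at most $\lceil |V(G)|/k\rceil$ vertices. $G$ is equitably $k$-list arborable if for every $k$-uniform list assignment $L$ there is an equitable $L$-colouring of $G$ in which every colour class induces an acyclic subgraph. -}

module Defs where

open import Data.Nat using (ℕ; zero; suc; _+_; _≤_; _/_)
open import Data.Nat.Properties using (_≟_)
open import Data.Fin using (Fin; toℕ)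
open import Data.List using (List; []; _∷_; length; filter; allFin; cartesianProduct)
open import Data.List.Membership.Propositional using (_∈_)
open import Data.List.Relation.Unary.All using (All)
open import Data.List.Relation.Unary.Unique.Propositional using (Unique)
open import Data.Product using (_×_; _,_; Σ)
open import Data.Sum using (_⊎_)
open import Data.Empty using (⊥)
open import Data.Unit using (⊤)
open import Relation.Nullary using (¬_)
open import Relation.Binary.PropositionalEquality using (_≡_)

-- A finite simple graph: a vertex type, an adjacency relation and a
-- list enumerating every vertex exactly once.
record FinGraph : Set₁ where
  field
    V     : Set
    adj   : V → V → Set
    verts : List V
open FinGraph public

P : ℕ → FinGraph
P n = record
  { V = Fin n
  ; adj = λ i j → (suc (toℕ i) ≡ toℕ j) ⊎ (suc (toℕ j) ≡ toℕ i)
  ; verts = allFin n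
  }

infixr 6 _□_
_□_ : FinGraph → FinGraph → FinGraph
G □ H = record
  { V = V G × V H
  ; adj = λ { (g , h) (g' , h') →
              (adj G g g' × h ≡ h') ⊎ (g ≡ g' × adj H h h') }
  ; verts = cartesianProduct (verts G) (verts H)
  }

order : FinGraph → ℕ
order G = length (verts G)

-- Ceiling division ⌈ m / k ⌉ (the value for k = 0 is irrelevant).
⌈_/_⌉ : ℕ → ℕ → ℕ
⌈ m / zero ⌉ = 0
⌈ m / suc k ⌉ = (m + k) / suc k

Colour : Set
Colour = ℕ

record UniformListAssignment (G : FinGraph) (k : ℕ) : Set where
  field
    L       : V G → List Colour
    unique  : ∀ v → Unique (L v)
    size    : ∀ v → length (L v) ≡ k
open UniformListAssignment public

WalkAdj : (G : FinGraph) → List (V G) → Set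
WalkAdj G [] = ⊤
WalkAdj G (x ∷ []) = ⊤
WalkAdj G (x ∷ y ∷ ys) = adj G x y × WalkAdj G (y ∷ ys)

last : {A : Set} → A → List A → A
last x [] = x
last x (y ∷ ys) = last y ys

record Cycle (G : FinGraph) : Set where
  field
    v₀ : V G
    rest : List (V G)
    long : 2 ≤ length rest
    distinct : Unique (v₀ ∷ rest)
    path : WalkAdj G (v₀ ∷ rest)
    closing : adj G (last v₀ rest) v₀
open Cycle public

InducesAcyclic : (G : FinGraph) → (V G → Set) → Set
InducesAcyclic G S = (C : Cycle G) → All S (v₀ C ∷ rest C) → ⊥

classSize : (G : FinGraph) → (V G → Colour) → Colour → ℕ
classSize G c x = length (filter (λ v → c v ≟ x) (verts G))

record EquitableAcyclicLColouring (G : FinGraph) {k : ℕ}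
         (L : UniformListAssignment G k) : Set where
  field
    c         : V G → Colour
    inList    : ∀ v → c v ∈ UniformListAssignment.L L v
    equitable : ∀ x → classSize G c x ≤ ⌈ order G / k ⌉
    acyclic   : ∀ x → InducesAcyclic G (λ v → c v ≡ x)

EquitablyListArborable : FinGraph → ℕ → Set
EquitablyListArborable G k =
  (L : UniformListAssignment G k) → EquitableAcyclicLColouring G L

{-# OPTIONS --safe #-}
module Submission where

-- Vertices are numbered so that rungs (edges of P 2) join consecutive numbers, and
-- cut into blocks of k consecutive vertices; a colouring that repeats no colour inside
-- a block is equitable. It is acyclic as soon as the vertices can be ranked with every
-- vertex having at most one neighbour of its colour of no larger rank.
-- For k ≥ 3 colour greedily in the order of the numbers: a vertex has at most three
-- earlier neighbours, so besides the colours of its block it avoids at most one colour,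
-- and none if it is the last of its block.
-- For k = 2 the blocks are the rungs, so monochromatic cycles would lie in a single
-- layer P n₂ □ P n₃. Colour row by row so that in each layer every monochromatic
-- segment of a row has at most one neighbour of its colour in the previous row, and
-- rank a segment by the distance to the end of that edge.

open import Defs
open import Data.Bool using (Bool; true; false) renaming (_≟_ to _≟ᵇ_)
open import Data.Fin using (Fin; zero; suc; toℕ; fromℕ<; combine; remQuot)
open import Data.Fin.Patterns using (0F; 1F)
import Data.Fin.Properties as Fin
open import Data.Fin.Properties using (toℕ-injective; toℕ<n; toℕ-fromℕ<; fromℕ<-injective; injective⇒≤;
  toℕ-combine; combine-injective; remQuot-combine)
open import Data.List using (List; []; _∷_; length; lookup; map; filter; allFin; cartesianProduct; applyUpTo)
open import Data.List.Membership.Propositional using (_∈_; _∉_; find)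
open import Data.List.Membership.Propositional.Properties using (∈-lookup; ∈-applyUpTo⁺; ∈-filter⁻)
open import Data.List.Properties using (length-map; length-++; length-tabulate; length-applyUpTo)
open import Data.List.Relation.Unary.All as All using (All; []; _∷_)
open import Data.List.Relation.Unary.All.Properties using (¬Any⇒All¬)
open import Data.List.Relation.Unary.AllPairs using ([]; _∷_)
open import Data.List.Relation.Unary.Any using (here; there; any?; index)
open import Data.List.Relation.Unary.Any.Properties using (lookup-index)
open import Data.List.Relation.Unary.Unique.Propositional using (Unique)
open import Data.List.Relation.Unary.Unique.Propositional.Properties as Unique using ()
open import Data.Nat
open import Data.Nat.DivMod
open import Data.Nat.Divisibility using (m∣m*n)
open import Data.Nat.Properties
open import Data.Nat.Tactic.RingSolver using (solve-∀)
open import Data.List.Membership.DecPropositional _≟_ using (_∈?_)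
open import Data.Product using (Σ; ∃-syntax; _×_; _,_; proj₁; proj₂)
open import Data.Sum as Sum using (_⊎_; inj₁; inj₂; swap; [_,_]′)
open import Function using (_∘_; id; case_of_)
open import Relation.Nullary using (¬_; Dec; yes; no; ¬?; contradiction)
open import Relation.Nullary.Decidable using (decidable-stable; does; dec-true; dec-false; _×-dec_; _⊎-dec_)
open import Relation.Binary.Definitions using (tri<; tri≈; tri>)
open import Relation.Binary.PropositionalEquality

-- Pigeonhole for lists without repetition.

lookup-injective : ∀ {A : Set} {xs : List A} → Unique xs → ∀ i j → lookup xs i ≡ lookup xs j → i ≡ j
lookup-injective (x≢ ∷ u) zero    zero    eq = refl
lookup-injective (x≢ ∷ u) zero    (suc j) eq = contradiction eq (All.lookup x≢ (∈-lookup j))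
lookup-injective (x≢ ∷ u) (suc i) zero    eq = contradiction (sym eq) (All.lookup x≢ (∈-lookup i))
lookup-injective (x≢ ∷ u) (suc i) (suc j) eq = cong suc (lookup-injective u i j eq)

-- `f` takes the membership proof, so it need only be defined on the members of the list.
unique-length-≤ : ∀ {A : Set} {B} {xs : List A} → Unique xs → (f : ∀ {x} → x ∈ xs → Fin B) →
  (∀ {x y} (p : x ∈ xs) (q : y ∈ xs) → f p ≡ f q → x ≡ y) → length xs ≤ B
unique-length-≤ u f inj = injective⇒≤ {f = λ i → f (∈-lookup i)}
  λ {i} {j} eq → lookup-injective u i j (inj (∈-lookup i) (∈-lookup j) eq)

-- Were every member of `xs` in `ys`, its index there would inject `xs` into the shorter `ys`.
avoiding : ∀ {xs ys : List Colour} → Unique xs → length ys < length xs → ∃[ x ] (x ∈ xs × x ∉ ys)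
avoiding {xs} {ys} u ys<xs with any? (λ x → ¬? (x ∈? ys)) xs
... | yes p = find p
... | no ¬p = contradiction (unique-length-≤ u (index ∘ inYs) same-index⇒≡) (<⇒≱ ys<xs)
  where
  inYs : ∀ {x} → x ∈ xs → x ∈ ys
  inYs {x} x∈xs = decidable-stable (x ∈? ys) (All.lookup (¬Any⇒All¬ xs ¬p) x∈xs)
  same-index⇒≡ : ∀ {x y} (p : x ∈ xs) (q : y ∈ xs) → index (inYs p) ≡ index (inYs q) → x ≡ y
  same-index⇒≡ p q eq =
    trans (lookup-index (inYs p)) (trans (cong (lookup ys) eq) (sym (lookup-index (inYs q))))

penultimate : {A : Set} → A → A → List A → A
penultimate p v []       = p
penultimate p v (q ∷ qs) = penultimate v q qs

∈-last : ∀ {A : Set} (x : A) xs → last x xs ∈ x ∷ xs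
∈-last x []       = here refl
∈-last x (y ∷ xs) = there (∈-last y xs)

-- Acyclicity from a ranking

-- A cycle would contain a vertex of maximal rank, whose two neighbours on the
-- cycle both have at most its rank.
module _ (G : FinGraph) (adj-sym : ∀ {v w} → adj G v w → adj G w v)
  (S : V G → Set) (rank : V G → ℕ)
  (parent-unique : ∀ {v p q} → S v → S p → S q → adj G v p → adj G v q →
                   rank p ≤ rank v → rank q ≤ rank v → p ≡ q) where

  private
    -- Otherwise `p` and `q` would be two distinct neighbours of `v` of no larger rank.
    noPeak : ∀ {p v q} → adj G p v → adj G v q → S p → S v → S q → p ≢ q →
             rank p ≤ rank v → rank v < rank q
    noPeak pv vq sp sv sq p≢q p≤v =
      ≰⇒> λ q≤v → p≢q (parent-unique sv sp sq (adj-sym pv) vq p≤v q≤v)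

    -- By `noPeak`, one weak rise forces a strict rise at every later step, so the walk cannot end
    -- with a drop.
    ascending : ∀ p v zs → WalkAdj G (p ∷ v ∷ zs) → All S (p ∷ v ∷ zs) → Unique (p ∷ v ∷ zs) →
      rank p ≤ rank v → rank v ≤ rank (last v zs) × rank (penultimate p v zs) ≤ rank (last v zs)
    ascending p v [] w s u p≤v = ≤-refl , p≤v
    ascending p v (q ∷ zs) (pv , vq , w) (sp ∷ sv ∷ sq ∷ s) ((_ ∷ p≢q ∷ _) ∷ u) p≤v =
      let v<q       = noPeak pv vq sp sv sq p≢q p≤v
          q≤l , r   = ascending v q zs (vq , w) (sv ∷ sq ∷ s) u (<⇒≤ v<q)
      in ≤-trans (<⇒≤ v<q) q≤l , r

    -- A rise anywhere would persist to the end by `ascending`, so a final drop means that every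
    -- step drops.
    descending : ∀ p v zs → WalkAdj G (p ∷ v ∷ zs) → All S (p ∷ v ∷ zs) → Unique (p ∷ v ∷ zs) →
      rank (last v zs) < rank (penultimate p v zs) → rank (last v zs) < rank p
    descending p v [] w s u l<p = l<p
    descending p v (q ∷ zs) (pv , w) (sp ∷ s) (p≢ ∷ u) l<pen with rank p ≤? rank v
    ... | yes p≤v = contradiction (proj₂ (ascending p v (q ∷ zs) (pv , w) (sp ∷ s) (p≢ ∷ u) p≤v)) (<⇒≱ l<pen)
    ... | no p≰v = <-trans (descending v q zs w s u l<pen) (≰⇒> p≰v)

    closing-triple : ∀ p v zs x → WalkAdj G (p ∷ v ∷ zs) → All S (p ∷ v ∷ zs) → S x →
      adj G (last v zs) x → x ≢ penultimate p v zs →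
      rank (penultimate p v zs) ≤ rank (last v zs) → rank (last v zs) < rank x
    closing-triple p v [] x (pv , _) (sp ∷ sv ∷ []) sx lx x≢ = noPeak pv lx sp sv sx (x≢ ∘ sym)
    closing-triple p v (q ∷ zs) x (pv , w) (sp ∷ s) sx lx x≢ = closing-triple v q zs x w s sx lx x≢

    head≢penultimate : ∀ (x p v : V G) zs → All (x ≢_) (p ∷ v ∷ zs) → x ≢ penultimate p v zs
    head≢penultimate x p v []       (x≢p ∷ _) = x≢p
    head≢penultimate x p v (q ∷ zs) (_ ∷ x≢)  = head≢penultimate x v q zs x≢

  unique-parents⇒acyclic : InducesAcyclic G S
  unique-parents⇒acyclic record { v₀ = a ; rest = b ∷ c ∷ zs ; distinct = u@(a≢ ∷ (b≢ ∷ _))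
                                ; path = w ; closing = la } s@(sa ∷ sb ∷ _)
    with rank a ≤? rank b
  -- The path rises from `a` to its last vertex, and `noPeak` there forces a further strict rise
  -- back to `a`.
  ... | yes a≤b = <⇒≱ (closing-triple a b (c ∷ zs) a w s sa la (head≢penultimate a b c zs a≢) (proj₂ asc))
                      (≤-trans a≤b (proj₁ asc))
    where asc = ascending a b (c ∷ zs) w s u a≤b
  -- Here `noPeak` at `a` puts the last vertex above `a`. The final step of the path must then drop,
  -- so the whole path descends from `a`, which puts the last vertex below `a`.
  ... | no a≰b = <-asym a<l (descending a b (c ∷ zs) w s u (≰⇒> λ pen≤l →
                   <-asym a<l (closing-triple a b (c ∷ zs) a w s sa la (head≢penultimate a b c zs a≢) pen≤l)))
    where
    l∈ = ∈-last c zs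
    a<l : rank a < rank (last c zs)
    a<l = noPeak (adj-sym (proj₁ w)) (adj-sym la) sb sa
            (All.lookup s (there (there l∈))) (All.lookup b≢ l∈) (≰⇒≥ a≰b)
  unique-parents⇒acyclic record { rest = _ ∷ [] ; long = s≤s () }
  unique-parents⇒acyclic record { rest = [] ; long = () }

-- Equitability from rainbow blocks.

quotient<ceiling : ∀ {p n} k → p < n → p / suc k < ⌈ n / suc k ⌉
quotient<ceiling {p} {n} k p<n = begin-strict
  p / suc k                 <⟨ n<1+n _ ⟩
  suc (p / suc k)           ≡⟨ cong (λ x → suc (x / suc k)) (m+n∸n≡m p (suc k)) ⟨
  suc ((p + suc k ∸ suc k) / suc k) ≡⟨ m/n≡1+[m∸n]/n (m≤n+m (suc k) p) ⟨
  (p + suc k) / suc k       ≤⟨ /-monoˡ-≤ (suc k) (≤-trans (≤-reflexive (+-suc p k)) (+-monoˡ-≤ k p<n)) ⟩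
  (n + k) / suc k ∎
  where open ≤-Reasoning

-- Sending a vertex to its block is injective on a colour class, and the bound is the number of
-- blocks.
blocks-rainbow⇒equitable : ∀ (G : FinGraph) k → Unique (verts G) →
  (pos : V G → ℕ) → (∀ v → pos v < order G) → (c : V G → Colour) →
  (∀ v w → pos v / suc k ≡ pos w / suc k → c v ≡ c w → v ≡ w) →
  ∀ x → classSize G c x ≤ ⌈ order G / suc k ⌉
blocks-rainbow⇒equitable G k u pos pos< c rainbow x =
  unique-length-≤ (Unique.filter⁺ inClass? u) block λ p q eq →
    rainbow _ _ (fromℕ<-injective _ _ (quotient<ceiling k (pos< _)) (quotient<ceiling k (pos< _)) eq)
      (trans (coloured p) (sym (coloured q)))
  where
  inClass? = λ v → c v ≟ x
  coloured : ∀ {v} → v ∈ filter inClass? (verts G) → c v ≡ x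
  coloured p = proj₂ (∈-filter⁻ inClass? {xs = verts G} p)
  block : ∀ {v} → v ∈ filter inClass? (verts G) → Fin ⌈ order G / suc k ⌉
  block {v} _ = fromℕ< (quotient<ceiling k (pos< v))

-- The grid and the numbering of its vertices.

P-adj-sym : ∀ n {i j} → adj (P n) i j → adj (P n) j i
P-adj-sym n = swap

□-adj-sym : ∀ G H → (∀ {v w} → adj G v w → adj G w v) → (∀ {v w} → adj H v w → adj H w v) →
  ∀ {v w} → adj (G □ H) v w → adj (G □ H) w v
□-adj-sym G H G-sym H-sym (inj₁ (gg' , eq)) = inj₁ (G-sym gg' , sym eq)
□-adj-sym G H G-sym H-sym (inj₂ (eq , hh')) = inj₂ (sym eq , H-sym hh')

length-cartesianProduct : ∀ {A B : Set} (xs : List A) (ys : List B) →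
  length (cartesianProduct xs ys) ≡ length xs * length ys
length-cartesianProduct []       ys = refl
length-cartesianProduct (x ∷ xs) ys =
  trans (length-++ (map (x ,_) ys)) (cong₂ _+_ (length-map (x ,_) ys) (length-cartesianProduct xs ys))

Grid : ℕ → ℕ → FinGraph
Grid m n = P 2 □ P m □ P n

module _ {m n : ℕ} where

  Grid-adj-sym : ∀ {v w} → adj (Grid m n) v w → adj (Grid m n) w v
  Grid-adj-sym = □-adj-sym (P 2) (P m □ P n) (P-adj-sym 2) (□-adj-sym (P m) (P n) (P-adj-sym m) (P-adj-sym n))

  order-Grid : order (Grid m n) ≡ m * n * 2
  order-Grid = begin
    order (Grid m n)                           ≡⟨ length-cartesianProduct (allFin 2) (verts (P m □ P n)) ⟩
    2 * order (P m □ P n)                      ≡⟨ cong (2 *_) (length-cartesianProduct (allFin m) (allFin n)) ⟩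
    2 * (length (allFin m) * length (allFin n)) ≡⟨ cong (2 *_) (cong₂ _*_ (length-tabulate {n = m} id)
                                                                         (length-tabulate {n = n} id)) ⟩
    2 * (m * n)                                ≡⟨ *-comm 2 (m * n) ⟩
    m * n * 2                                  ∎
    where open ≡-Reasoning

  verts-Grid-unique : Unique (verts (Grid m n))
  verts-Grid-unique = Unique.cartesianProduct⁺ (Unique.allFin⁺ 2)
    (Unique.cartesianProduct⁺ (Unique.allFin⁺ m) (Unique.allFin⁺ n))

  -- The `P 2` coordinate is the least significant digit, which makes the ends of a rung
  -- consecutive.
  index-of : V (Grid m n) → Fin (m * n * 2)
  index-of (a , i , j) = combine (combine i j) a

  vertex-at : Fin (m * n * 2) → V (Grid m n)
  vertex-at t = let ij , a = remQuot {m * n} 2 t ; i , j = remQuot {m} n ij in a , i , j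

  vertex-at-index-of : ∀ v → vertex-at (index-of v) ≡ v
  vertex-at-index-of (a , i , j) = trans
    (cong (λ (ij , a) → let i , j = remQuot {m} n ij in a , i , j) (remQuot-combine {m * n} {2} (combine i j) a))
    (cong (a ,_) (remQuot-combine {m} {n} i j))

  pos : V (Grid m n) → ℕ
  pos v = toℕ (index-of v)

  pos-def : ∀ a i j → pos (a , i , j) ≡ 2 * (n * toℕ i + toℕ j) + toℕ a
  pos-def a i j = trans (toℕ-combine (combine i j) a) (cong (λ x → 2 * x + toℕ a) (toℕ-combine i j))

  pos-injective : ∀ {v w} → pos v ≡ pos w → v ≡ w
  pos-injective {v} {w} eq =
    trans (sym (vertex-at-index-of v)) (trans (cong vertex-at (toℕ-injective eq)) (vertex-at-index-of w))

  pos< : ∀ v → pos v < order (Grid m n)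
  pos< v = subst (pos v <_) (sym order-Grid) (toℕ<n (index-of v))

-- Lists of at least three colours

-- The three directions of edges; `⟦_⟧` gives the difference of positions along each.
data Offset : Set where
  rung along across : Offset

module Greedy (n : ℕ) .{{_ : NonZero n}} where

  ⟦_⟧ : Offset → ℕ
  ⟦ rung ⟧   = 1
  ⟦ along ⟧  = 2
  ⟦ across ⟧ = 2 * n

  ⟦⟧>0 : ∀ d → 0 < ⟦ d ⟧
  ⟦⟧>0 rung   = s≤s z≤n
  ⟦⟧>0 along  = s≤s z≤n
  ⟦⟧>0 across = ≤-trans (>-nonZero⁻¹ n) (m≤n*m n 2)

  module _ {m : ℕ} where

    rung-step : ∀ {i : Fin m} {j : Fin n} {a b} → suc (toℕ a) ≡ toℕ b → pos (b , i , j) ≡ 1 + pos (a , i , j)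
    rung-step {i} {j} {a} {b} eq rewrite pos-def a i j | pos-def b i j | sym eq = +-suc _ (toℕ a)

    along-step : ∀ {a} {i : Fin m} {j j' : Fin n} → suc (toℕ j) ≡ toℕ j' → pos (a , i , j') ≡ 2 + pos (a , i , j)
    along-step {a} {i} {j} {j'} eq rewrite pos-def a i j | pos-def a i j' | sym eq =
      arith n (toℕ i) (toℕ j) (toℕ a)
      where
      arith : ∀ n i j a → 2 * (n * i + (1 + j)) + a ≡ 2 + (2 * (n * i + j) + a)
      arith = solve-∀

    across-step : ∀ {a} {i i' : Fin m} {j : Fin n} → suc (toℕ i) ≡ toℕ i' →
      pos (a , i' , j) ≡ 2 * n + pos (a , i , j)
    across-step {a} {i} {i'} {j} eq rewrite pos-def a i j | pos-def a i' j | sym eq =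
      arith n (toℕ i) (toℕ j) (toℕ a)
      where
      arith : ∀ n i j a → 2 * (n * (1 + i) + j) + a ≡ 2 * n + (2 * (n * i + j) + a)
      arith = solve-∀

    adj⇒offset : ∀ {v w} → adj (Grid m n) v w →
      ∃[ d ] (pos w ≡ ⟦ d ⟧ + pos v ⊎ pos v ≡ ⟦ d ⟧ + pos w)
    adj⇒offset (inj₁ (inj₁ eq , refl))                   = rung , inj₁ (rung-step eq)
    adj⇒offset (inj₁ (inj₂ eq , refl))                   = rung , inj₂ (rung-step eq)
    adj⇒offset {v = a , _} (inj₂ (refl , inj₁ (inj₁ eq , refl))) = across , inj₁ (across-step {a} eq)
    adj⇒offset {v = a , _} (inj₂ (refl , inj₁ (inj₂ eq , refl))) = across , inj₂ (across-step {a} eq)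
    adj⇒offset {v = a , i , _} (inj₂ (refl , inj₂ (refl , inj₁ eq))) = along , inj₁ (along-step {a} {i} eq)
    adj⇒offset {v = a , i , _} (inj₂ (refl , inj₂ (refl , inj₂ eq))) = along , inj₂ (along-step {a} {i} eq)

    earlier-offset : ∀ {v w} → adj (Grid m n) v w → pos w ≤ pos v → ∃[ d ] pos v ≡ ⟦ d ⟧ + pos w
    earlier-offset vw w≤v with adj⇒offset vw
    ... | d , inj₂ eq = d , eq
    ... | d , inj₁ eq = contradiction (subst (_≤ _) eq w≤v) (<⇒≱ (m<n+m _ (⟦⟧>0 d)))

  module _ (κ : ℕ) (ℓ : ℕ → List Colour)
    (ℓ-unique : ∀ t → Unique (ℓ t)) (ℓ-size : ∀ t → length (ℓ t) ≡ 3 + κ) where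

    k : ℕ
    k = 3 + κ

    -- The `t % k` positions just before `t` are those of its block that are already coloured.
    blockColours : ℕ → (ℕ → Colour) → List Colour
    blockColours t h = applyUpTo (λ i → h (t ∸ suc i)) (t % k)

    -- Offsets exceeding t are truncated to position 0, which only forbids more.
    repeated : ℕ → (ℕ → Colour) → Colour
    repeated t h with h (t ∸ ⟦ rung ⟧) ≟ h (t ∸ ⟦ along ⟧)
    ... | yes _ = h (t ∸ ⟦ rung ⟧)
    ... | no  _ = h (t ∸ ⟦ across ⟧)

    -- The length has to stay below `k`. At the last vertex of a block the block colours already
    -- number `k - 1`, which leaves no room for a reserved colour.
    avoided : ℕ → (ℕ → Colour) → List Colour
    avoided t h with suc (t % k) <? k
    ... | yes _ = repeated t h ∷ blockColours t h
    ... | no  _ = blockColours t h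

    avoided-length : ∀ t h → length (avoided t h) < length (ℓ t)
    avoided-length t h rewrite ℓ-size t with suc (t % k) <? k
    ... | yes p rewrite length-applyUpTo (λ i → h (t ∸ suc i)) (t % k) = p
    ... | no  _ rewrite length-applyUpTo (λ i → h (t ∸ suc i)) (t % k) = m%n<n t k

    blockColours⊆avoided : ∀ t h {x} → x ∈ blockColours t h → x ∈ avoided t h
    blockColours⊆avoided t h x∈ with suc (t % k) <? k
    ... | yes _ = there x∈
    ... | no  _ = x∈

    choice : ∀ t h → ∃[ x ] (x ∈ ℓ t × x ∉ avoided t h)
    choice t h = avoiding (ℓ-unique t) (avoided-length t h)

    -- Course-of-values recursion in structural form: a table of the colours chosen below `t`, with
    -- default 0 from `t` on.
    history : ℕ → ℕ → Colour
    history zero    s = 0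
    history (suc t) s with s ≟ t
    ... | yes _ = proj₁ (choice t (history t))
    ... | no  _ = history t s

    greedy : ℕ → Colour
    greedy t = proj₁ (choice t (history t))

    greedy∈ : ∀ t → greedy t ∈ ℓ t
    greedy∈ t = proj₁ (proj₂ (choice t (history t)))

    greedy∉ : ∀ t → greedy t ∉ avoided t (history t)
    greedy∉ t = proj₂ (proj₂ (choice t (history t)))

    history≡greedy : ∀ {t s} → s < t → history t s ≡ greedy s
    history≡greedy {suc t} {s} s<1+t with s ≟ t
    ... | yes refl = refl
    ... | no s≢t   = history≡greedy (≤∧≢⇒< (s≤s⁻¹ s<1+t) s≢t)

    -- The entry of `s` has index `t - s - 1`, which is below `t % k` because the block starts at
    -- `t / k * k`, no later than `s`.
    same-block⇒∈ : ∀ {s t} → s < t → s / k ≡ t / k → greedy s ∈ blockColours t (history t)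
    same-block⇒∈ {s} {suc t} s<t eq = subst (_∈ blockColours (suc t) (history (suc t)))
      (trans (cong (history (suc t)) (m∸[m∸n]≡n (s≤s⁻¹ s<t))) (history≡greedy s<t))
      (∈-applyUpTo⁺ _ (begin-strict
        suc t ∸ suc s             <⟨ ∸-monoʳ-< (n<1+n s) s<t ⟩
        suc t ∸ s                 ≤⟨ ∸-monoʳ-≤ (suc t) (≤-trans (≤-reflexive (cong (_* k) (sym eq))) (m/n*n≤m s k)) ⟩
        suc t ∸ suc t / k * k     ≡⟨ m%n≡m∸m/n*n (suc t) k ⟨
        suc t % k                 ∎))
      where open ≤-Reasoning

    greedy-rainbow : ∀ {s t} → s < t → s / k ≡ t / k → greedy s ≢ greedy t
    greedy-rainbow {s} {t} s<t eq same =
      greedy∉ t (blockColours⊆avoided t _ (subst (_∈ blockColours t (history t)) same (same-block⇒∈ s<t eq)))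

    -- Among three colours at most one value repeats: the common value of the first two, or else the
    -- third. Hence reserving one colour suffices.
    repeated-among-three : ∀ t h {x} d d' → h (t ∸ ⟦ d ⟧) ≡ x → h (t ∸ ⟦ d' ⟧) ≡ x → d ≡ d' ⊎ x ≡ repeated t h
    repeated-among-three t h d d' p q with h (t ∸ ⟦ rung ⟧) ≟ h (t ∸ ⟦ along ⟧)
    repeated-among-three t h rung   rung   p q | _      = inj₁ refl
    repeated-among-three t h along  along  p q | _      = inj₁ refl
    repeated-among-three t h across across p q | _      = inj₁ refl
    repeated-among-three t h rung   _      p q | yes _  = inj₂ (sym p)
    repeated-among-three t h along  _      p q | yes eq = inj₂ (sym (trans eq p))
    repeated-among-three t h across rung   p q | yes _  = inj₂ (sym q)
    repeated-among-three t h across along  p q | yes eq = inj₂ (sym (trans eq q))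
    repeated-among-three t h rung   along  p q | no ≢   = contradiction (trans p (sym q)) ≢
    repeated-among-three t h along  rung   p q | no ≢   = contradiction (trans q (sym p)) ≢
    repeated-among-three t h _      across p q | no _   = inj₂ (sym q)
    repeated-among-three t h across _      p q | no _   = inj₂ (sym p)

    -- Since k ≥ 3, the last vertex of a block has two of its three candidate
    -- neighbours inside that block, so no colour needs to be reserved for repetition.
    avoided-covers : ∀ t h → repeated t h ∈ avoided t h ⊎
      (h (t ∸ ⟦ rung ⟧) ∈ avoided t h × h (t ∸ ⟦ along ⟧) ∈ avoided t h)
    avoided-covers t h with suc (t % k) <? k
    ... | yes _   = inj₁ (here refl)
    ... | no last = inj₂ (∈-applyUpTo⁺ _ (≤-trans (s≤s z≤n) 2≤) , ∈-applyUpTo⁺ _ 2≤)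
      where
      2≤ : 2 ≤ t % k
      2≤ = ≤-trans (m≤m+n 2 κ) (s≤s⁻¹ (≮⇒≥ last))

    -- If the repeated colour is not avoided, the `rung` and `along` colours both are, so `x` can
    -- only occur at `across`.
    no-two-offsets : ∀ t h {x} → x ∉ avoided t h → ∀ d d' → h (t ∸ ⟦ d ⟧) ≡ x → h (t ∸ ⟦ d' ⟧) ≡ x → d ≡ d'
    no-two-offsets t h x∉ d d' p q with repeated-among-three t h d d' p q | avoided-covers t h
    ... | inj₁ eq   | _       = eq
    ... | inj₂ refl | inj₁ r∈ = contradiction r∈ x∉
    no-two-offsets t h x∉ rung   _     p q | _ | inj₂ (r∈ , _) = contradiction (subst (_∈ avoided t h) p r∈) x∉
    no-two-offsets t h x∉ along  _     p q | _ | inj₂ (_ , a∈) = contradiction (subst (_∈ avoided t h) p a∈) x∉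
    no-two-offsets t h x∉ across rung  p q | _ | inj₂ (r∈ , _) = contradiction (subst (_∈ avoided t h) q r∈) x∉
    no-two-offsets t h x∉ across along p q | _ | inj₂ (_ , a∈) = contradiction (subst (_∈ avoided t h) q a∈) x∉
    no-two-offsets t h x∉ across across p q | _ | _ = refl

    greedy-one-earlier : ∀ {t s s'} d d' → t ≡ ⟦ d ⟧ + s → t ≡ ⟦ d' ⟧ + s' →
      greedy s ≡ greedy t → greedy s' ≡ greedy t → s ≡ s'
    greedy-one-earlier {t} {s} {s'} d d' eq eq' p q
      with no-two-offsets t (history t) (greedy∉ t) d d' (recall d eq p) (recall d' eq' q)
      where
      recall : ∀ {s x} d → t ≡ ⟦ d ⟧ + s → greedy s ≡ x → history t (t ∸ ⟦ d ⟧) ≡ x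
      recall {s} d refl p = trans (cong (history t) (m+n∸m≡n ⟦ d ⟧ s))
        (trans (history≡greedy (m<n+m s (⟦⟧>0 d))) p)
    ... | refl = +-cancelˡ-≡ ⟦ d ⟧ s s' (trans (sym eq) eq')

  module _ (κ : ℕ) {m : ℕ} .{{_ : NonZero m}} (L : UniformListAssignment (Grid m n) (3 + κ)) where

    private
      instance
        order≢0 : NonZero (m * n * 2)
        order≢0 = m*n≢0 (m * n) 2 {{m*n≢0 m n}}

      -- The greedy process runs over all of ℕ; reduction modulo the order supplies lists past the
      -- last vertex.
      listAt : ℕ → List Colour
      listAt t = UniformListAssignment.L L (vertex-at {m} {n} (t mod (m * n * 2)))

      listAt-pos : ∀ v → listAt (pos v) ≡ UniformListAssignment.L L v
      listAt-pos v = cong (UniformListAssignment.L L) (trans (cong vertex-at (toℕ-injective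
        (trans (toℕ-fromℕ< _) (m<n⇒m%n≡m (toℕ<n (index-of v)))))) (vertex-at-index-of v))

      colourAt : ℕ → Colour
      colourAt = greedy κ listAt (λ _ → unique L _) (λ _ → size L _)

      colour : V (Grid m n) → Colour
      colour v = colourAt (pos v)

      rainbow : ∀ v w → pos v / (3 + κ) ≡ pos w / (3 + κ) → colour v ≡ colour w → v ≡ w
      rainbow v w eq same with <-cmp (pos v) (pos w)
      ... | tri< v<w _ _ = contradiction same (greedy-rainbow κ listAt _ _ v<w eq)
      ... | tri≈ _ v≡w _ = pos-injective v≡w
      ... | tri> _ _ w<v = contradiction (sym same) (greedy-rainbow κ listAt _ _ w<v (sym eq))

      one-earlier : ∀ {x v p q} → colour v ≡ x → colour p ≡ x → colour q ≡ x →
        adj (Grid m n) v p → adj (Grid m n) v q → pos p ≤ pos v → pos q ≤ pos v → p ≡ q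
      one-earlier cv cp cq vp vq p≤v q≤v =
        let d  , eq  = earlier-offset vp p≤v
            d' , eq' = earlier-offset vq q≤v
        in pos-injective (greedy-one-earlier κ listAt _ _ d d' eq eq' (trans cp (sym cv)) (trans cq (sym cv)))

    greedy-colouring : EquitableAcyclicLColouring (Grid m n) L
    greedy-colouring = record
      { c         = colour
      ; inList    = λ v → subst (colour v ∈_) (listAt-pos v) (greedy∈ κ listAt _ _ (pos v))
      ; equitable = blocks-rainbow⇒equitable (Grid m n) (2 + κ) verts-Grid-unique pos pos< colour rainbow
      ; acyclic   = λ x → unique-parents⇒acyclic (Grid m n) Grid-adj-sym (λ v → colour v ≡ x) pos one-earlier
      }

-- Lists of two colours

record Layer (n : ℕ) : Set where
  field
    col : Fin n → Colour
    sat : Fin n → Bool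
open Layer

-- Position 0 is the most recently coloured one.
HeadSat : ∀ {n} → Layer n → Colour → Set
HeadSat l x = ∃[ j ] (toℕ j ≡ 0 × sat l j ≡ true × col l j ≡ x)

HeadSat? : ∀ {n} (l : Layer n) x → Dec (HeadSat l x)
HeadSat? l x = Fin.any? λ j → (toℕ j ≟ 0) ×-dec (sat l j ≟ᵇ true) ×-dec (col l j ≟ x)

HeadSat-unique : ∀ {n} (l : Layer n) {x y} → HeadSat l x → HeadSat l y → x ≡ y
HeadSat-unique l (j , j≡0 , _ , refl) (j' , j'≡0 , _ , refl) = cong (col l) (toℕ-injective (trans j≡0 (sym j'≡0)))

-- Saturation of j records that j has a parent among the cell above it (of
-- colour u j) and its neighbour j + 1; an unsaturated cell may take j - 1 as its parent.
record Valid {n} (u : Fin n → Colour) (l : Layer n) : Set where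
  field
    above : ∀ j → col l j ≡ u j → sat l j ≡ true
    beside : ∀ {j j'} → suc (toℕ j) ≡ toℕ j' → sat l j' ≡ true → col l j' ≡ col l j →
      sat l j ≡ true × col l j ≢ u j
open Valid

-- An older neighbour of the same colour becomes a parent of the new cell only if it is saturated;
-- otherwise it takes the new cell as its own parent.
extend : ∀ {n} → Colour → Layer n → Colour → Layer (suc n)
extend u l t = record
  { col = λ { zero → t ; (suc j) → col l j }
  ; sat = λ { zero → does ((t ≟ u) ⊎-dec HeadSat? l t) ; (suc j) → sat l j }
  }

-- The disjunction excludes the one conflict: a parent above together with a saturated older
-- neighbour of the same colour.
extend-valid : ∀ {n} {u : Fin (suc n) → Colour} {l t} → Valid (u ∘ suc) l →
  t ≢ u zero ⊎ ¬ HeadSat l t → Valid u (extend (u zero) l t)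
extend-valid {u = u} {l} {t} valid free = record { above = above′ ; beside = beside′ }
  where
  above′ : ∀ j → col (extend (u zero) l t) j ≡ u j → sat (extend (u zero) l t) j ≡ true
  above′ zero    eq = dec-true ((t ≟ u zero) ⊎-dec HeadSat? l t) (inj₁ eq)
  above′ (suc j) eq = above valid j eq
  beside′ : ∀ {j j'} → suc (toℕ j) ≡ toℕ j' → sat (extend (u zero) l t) j' ≡ true →
    col (extend (u zero) l t) j' ≡ col (extend (u zero) l t) j →
    sat (extend (u zero) l t) j ≡ true × col (extend (u zero) l t) j ≢ u j
  beside′ {zero} {suc j'} eq s same =
    dec-true ((t ≟ u zero) ⊎-dec HeadSat? l t) (inj₂ headSat) , [ id , contradiction headSat ]′ free
    where
    headSat : HeadSat l t
    headSat = j' , sym (suc-injective eq) , s , same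
  beside′ {suc j} {suc j'} eq s same = beside valid (suc-injective eq) s same

extend-unsaturated : ∀ {n} {u} {l : Layer n} {t x} → t ≢ u → ¬ HeadSat l t → ¬ HeadSat (extend u l t) x
extend-unsaturated {u = u} {l} {t} t≢u ¬sat (zero , _ , s , _) =
  case trans (sym s) (dec-false ((t ≟ u) ⊎-dec HeadSat? l t) [ t≢u , ¬sat ]′) of λ ()

extend-other : ∀ {n} {u} {l : Layer n} {t x} → t ≢ x → ¬ HeadSat (extend u l t) x
extend-other t≢x (zero , _ , _ , t≡x) = t≢x t≡x

-- `u` holds the colours of the previous row. `rungs` makes the blocks of size two rainbow and
-- confines monochromatic edges to one layer.
record RowColouring {n} (u : Fin 2 → Fin n → Colour) (ℓ : Fin 2 → Fin n → List Colour) : Set where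
  field
    layer  : Fin 2 → Layer n
    valid  : ∀ a → Valid (u a) (layer a)
    listed : ∀ a j → col (layer a) j ∈ ℓ a j
    rungs  : ∀ {a b} j → col (layer a) j ≡ col (layer b) j → a ≡ b
open RowColouring

extend-row : ∀ {n} {u : Fin 2 → Fin (suc n) → Colour} {ℓ : Fin 2 → Fin (suc n) → List Colour} →
  (R : RowColouring (λ a → u a ∘ suc) (λ a → ℓ a ∘ suc)) {s t : Colour} →
  s ∈ ℓ 0F zero → t ∈ ℓ 1F zero → s ≢ t →
  s ≢ u 0F zero ⊎ ¬ HeadSat (layer R 0F) s → t ≢ u 1F zero ⊎ ¬ HeadSat (layer R 1F) t →
  RowColouring u ℓ
extend-row {u = u} {ℓ} R {s} {t} s∈ t∈ s≢t free₀ free₁ = record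
  { layer  = layer′
  ; valid  = λ { 0F → extend-valid (valid R 0F) free₀ ; 1F → extend-valid (valid R 1F) free₁ }
  ; listed = λ { 0F zero → s∈ ; 1F zero → t∈ ; 0F (suc j) → listed R 0F j ; 1F (suc j) → listed R 1F j }
  ; rungs  = rungs′ _ _
  }
  where
  layer′ : Fin 2 → Layer _
  layer′ 0F = extend (u 0F zero) (layer R 0F) s
  layer′ 1F = extend (u 1F zero) (layer R 1F) t
  rungs′ : ∀ a b j → col (layer′ a) j ≡ col (layer′ b) j → a ≡ b
  rungs′ 0F 0F j       eq = refl
  rungs′ 1F 1F j       eq = refl
  rungs′ 0F 1F zero    eq = contradiction eq s≢t
  rungs′ 1F 0F zero    eq = contradiction (sym eq) s≢t
  rungs′ 0F 1F (suc j) eq = rungs R j eq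
  rungs′ 1F 0F (suc j) eq = rungs R j eq

avoiding-one : ∀ {xs : List Colour} → Unique xs → length xs ≡ 2 → ∀ u → ∃[ x ] (x ∈ xs × x ≢ u)
avoiding-one uniq two u =
  let x , x∈ , x∉ = avoiding {ys = u ∷ []} uniq (≤-reflexive (sym two)) in x , x∈ , x∉ ∘ here

-- If the first choices `s` and `t` coincide, replacing one of them by the other colour of its list
-- fails only when that colour is the one above, on both sides.
rung-options : ∀ {xs ys : List Colour} → Unique xs → length xs ≡ 2 → Unique ys → length ys ≡ 2 → ∀ u v →
  (∃[ s ] ∃[ t ] (s ∈ xs × t ∈ ys × s ≢ t × s ≢ u × t ≢ v)) ⊎
  (∃[ α ] (u ∈ xs × α ∈ xs × v ∈ ys × α ∈ ys × α ≢ u × α ≢ v))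
rung-options uniq two uniq' two' u v with avoiding-one uniq two u | avoiding-one uniq' two' v
... | s , s∈ , s≢u | t , t∈ , t≢v with s ≟ t
... | no s≢t = inj₁ (s , t , s∈ , t∈ , s≢t , s≢u , t≢v)
... | yes refl with avoiding-one uniq two s | avoiding-one uniq' two' s
... | s' , s'∈ , s'≢s | t' , t'∈ , t'≢s with s' ≟ u | t' ≟ v
... | no s'≢u  | _        = inj₁ (s' , s , s'∈ , t∈ , s'≢s , s'≢u , t≢v)
... | yes _    | no t'≢v  = inj₁ (s , t' , s∈ , t'∈ , ≢-sym t'≢s , s≢u , t'≢v)
... | yes refl | yes refl = inj₂ (s , s'∈ , s∈ , t'∈ , t∈ , s≢u , t≢v)

-- A rung cannot be coloured only if its lists are {x, α} and {y, α}, where x and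
-- y are the colours above it, and the previous rung is saturated with x and y.
-- The induction keeps the freedom to avoid any given pair of saturated colours.
row-colouring : ∀ {n} (u : Fin 2 → Fin n → Colour) (ℓ : Fin 2 → Fin n → List Colour) →
  (∀ a j → Unique (ℓ a j)) → (∀ a j → length (ℓ a j) ≡ 2) → ∀ x y →
  Σ (RowColouring u ℓ) λ R → ¬ HeadSat (layer R 0F) x ⊎ ¬ HeadSat (layer R 1F) y
row-colouring {zero} u ℓ uniq two x y =
  record
    { layer  = λ _ → record { col = λ () ; sat = λ () }
    ; valid  = λ _ → record { above = λ () ; beside = λ { {()} } }
    ; listed = λ _ ()
    ; rungs  = λ ()
    }
  , inj₁ λ ()
row-colouring {suc n} u ℓ uniq two x y
  with rung-options (uniq 0F zero) (two 0F zero) (uniq 1F zero) (two 1F zero) (u 0F zero) (u 1F zero)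
     | row-colouring (λ a → u a ∘ suc) (λ a → ℓ a ∘ suc) (λ a → uniq a ∘ suc) (λ a → two a ∘ suc)
... | inj₁ (s , t , s∈ , t∈ , s≢t , s≢u , t≢v) | previous =
  -- Neither new cell matches the cell above, so it is saturated only through its older neighbour;
  -- asking the induction to avoid `s` and `t` leaves one of the two unsaturated.
  let R , unsat = previous s t in
  extend-row R s∈ t∈ s≢t (inj₁ s≢u) (inj₁ t≢v) ,
  Sum.map (extend-unsaturated s≢u) (extend-unsaturated t≢v) unsat
... | inj₂ (α , u∈ , α∈₀ , v∈ , α∈₁ , α≢u , α≢v) | previous with previous (u 0F zero) (u 1F zero)
... | R , inj₁ ¬sat-u with HeadSat? (layer R 1F) α | u 0F zero ≟ x
... | no ¬sat-α | _      = extend-row R u∈ α∈₁ (≢-sym α≢u) (inj₂ ¬sat-u) (inj₁ α≢v) ,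
  inj₂ (extend-unsaturated α≢v ¬sat-α)
... | yes _     | no u≢x = extend-row R u∈ α∈₁ (≢-sym α≢u) (inj₂ ¬sat-u) (inj₁ α≢v) ,
  inj₁ (extend-other u≢x)
-- The previous cell of layer `1F` has colour `α`, hence not `v`, so `v` is free there; layer `0F`
-- then gets `α`, which differs from `x`.
... | yes sat-α | yes refl =
  extend-row R α∈₀ v∈ α≢v (inj₁ α≢u) (inj₂ λ sat-v → α≢v (HeadSat-unique (layer R 1F) sat-α sat-v)) ,
  inj₁ (extend-other α≢u)
row-colouring {suc n} u ℓ uniq two x y
    | inj₂ (α , u∈ , α∈₀ , v∈ , α∈₁ , α≢u , α≢v) | previous | R , inj₂ ¬sat-v
  -- The mirror image, with the two layers exchanged.
  with HeadSat? (layer R 0F) α | u 1F zero ≟ y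
... | no ¬sat-α | _      = extend-row R α∈₀ v∈ α≢v (inj₁ α≢u) (inj₂ ¬sat-v) ,
  inj₁ (extend-unsaturated α≢u ¬sat-α)
... | yes _     | no v≢y = extend-row R α∈₀ v∈ α≢v (inj₁ α≢u) (inj₂ ¬sat-v) ,
  inj₂ (extend-other v≢y)
... | yes sat-α | yes refl =
  extend-row R u∈ α∈₁ (≢-sym α≢u) (inj₂ λ sat-u → α≢u (HeadSat-unique (layer R 0F) sat-α sat-u)) (inj₁ α≢v) ,
  inj₂ (extend-other α≢v)

-- Stacking the rows and ranking the vertices.

half : ∀ x (a : Fin 2) → (2 * x + toℕ a) / 2 ≡ x
half x a = begin
  (2 * x + toℕ a) / 2     ≡⟨ +-distrib-/-∣ˡ (toℕ a) (m∣m*n x) ⟩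
  2 * x / 2 + toℕ a / 2   ≡⟨ cong₂ _+_ (trans (cong (_/ 2) (*-comm 2 x)) (m*n/n≡m x 2)) (m<n⇒m/n≡0 (toℕ<n a)) ⟩
  x + 0                   ≡⟨ +-identityʳ x ⟩
  x                       ∎
  where open ≡-Reasoning

module RowByRow {m n : ℕ} (L : UniformListAssignment (Grid m n) 2) where

  private
    colours : ∀ {m'} {u ℓ} → RowColouring {m'} u ℓ → Fin 2 → Fin m' → Colour
    colours R a = col (layer R a)

    next-row : (u : Fin 2 → Fin n → Colour) (i : Fin m) →
      RowColouring u (λ a j → UniformListAssignment.L L (a , i , j))
    -- The pair of colours to avoid matters only within the induction along a row, so `0 0` is an
    -- arbitrary choice.
    next-row u i = proj₁ (row-colouring u _ (λ a j → unique L (a , i , j)) (λ a j → size L (a , i , j)) 0 0)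

    -- Nothing lies above the first row, so the colours assumed there are arbitrary.
    rows : ∀ {m'} → (Fin m' → Fin m) → (Fin 2 → Fin n → Colour) → Fin m' → Fin 2 → Fin n → Colour
    rows f u zero    = u
    rows f u (suc i) = rows (f ∘ suc) (colours (next-row u (f zero))) i

    rows-linked : ∀ {m'} (f : Fin m' → Fin m) u {i i'} → suc (toℕ i) ≡ toℕ i' →
      rows f u i' ≡ colours (next-row (rows f u i) (f i))
    rows-linked f u {zero}  {suc zero} eq = refl
    rows-linked f u {suc i} {suc i'}   eq = rows-linked (f ∘ suc) _ (suc-injective eq)

    above-row : Fin m → Fin 2 → Fin n → Colour
    above-row = rows id (λ _ _ → 0)

    row : ∀ i → RowColouring (above-row i) (λ a j → UniformListAssignment.L L (a , i , j))
    row i = next-row (above-row i) i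

    colour : V (Grid m n) → Colour
    colour (a , i , j) = col (layer (row i) a) j

    saturated : V (Grid m n) → Bool
    saturated (a , i , j) = sat (layer (row i) a) j

    -- Within a row, saturated cells have parents at larger `j` and unsaturated ones at smaller `j`.
    -- Both directions lower the rank, and no saturated cell ranks above an unsaturated one.
    rowRank : Bool → ℕ → ℕ
    rowRank true  j = n ∸ j
    rowRank false j = n + j

    -- The factor `n + n` exceeds every `rowRank`, so earlier rows rank strictly lower.
    rank : V (Grid m n) → ℕ
    rank v@(a , i , j) = toℕ i * (n + n) + rowRank (saturated v) (toℕ j)

    rowRank< : ∀ b (j : Fin n) → rowRank b (toℕ j) < n + n
    rowRank< true  j = ≤-<-trans (m∸n≤m n (toℕ j)) (m<m+n n (≤-<-trans z≤n (toℕ<n j)))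
    rowRank< false j = +-monoʳ-< n (toℕ<n j)

    rank-next-row : ∀ {a a' i i'} {j j' : Fin n} → suc (toℕ i) ≡ toℕ i' → rank (a , i , j) < rank (a' , i' , j')
    rank-next-row {a} {a'} {i} {i'} {j} {j'} eq = begin-strict
      rank (a , i , j)           <⟨ +-monoʳ-< (toℕ i * (n + n)) (rowRank< (saturated (a , i , j)) j) ⟩
      toℕ i * (n + n) + (n + n)  ≡⟨ +-comm (toℕ i * (n + n)) (n + n) ⟩
      suc (toℕ i) * (n + n)      ≡⟨ cong (_* (n + n)) eq ⟩
      toℕ i' * (n + n)           ≤⟨ m≤m+n _ _ ⟩
      rank (a' , i' , j')        ∎
      where open ≤-Reasoning

    -- The conditions on saturation and on the colour above make the constructors mutually
    -- exclusive, and each fixes its target.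
    data Parent : V (Grid m n) → V (Grid m n) → Set where
      up    : ∀ {a i i' j} → suc (toℕ i') ≡ toℕ i → saturated (a , i , j) ≡ true →
              colour (a , i , j) ≡ above-row i a j → Parent (a , i , j) (a , i' , j)
      older : ∀ {a i j j'} → suc (toℕ j) ≡ toℕ j' → saturated (a , i , j) ≡ true →
              colour (a , i , j) ≢ above-row i a j → Parent (a , i , j) (a , i , j')
      newer : ∀ {a i j j'} → suc (toℕ j') ≡ toℕ j → saturated (a , i , j) ≡ false → Parent (a , i , j) (a , i , j')

    adj⇒parent : ∀ {v w} → adj (Grid m n) v w → colour w ≡ colour v → rank w ≤ rank v → Parent v w
    adj⇒parent {a , i , j} (inj₁ (ab , refl)) same w≤v = contradiction ab
      (subst (λ b → ¬ adj (P 2) a b) (sym (rungs (row i) j same)) irreflexive)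
      where
      irreflexive : ¬ adj (P 2) a a
      irreflexive = [ 1+n≢n , 1+n≢n ]′
    adj⇒parent {a , i , j} (inj₂ (refl , inj₁ (inj₁ eq , refl))) same w≤v =
      contradiction w≤v (<⇒≱ (rank-next-row {a} {a} eq))
    adj⇒parent {a , i , j} {_ , i' , _} (inj₂ (refl , inj₁ (inj₂ eq , refl))) same w≤v =
      up eq (above (valid (row i) a) j same-above) same-above
      where
      same-above : colour (a , i , j) ≡ above-row i a j
      same-above = trans (sym same) (sym (cong (λ f → f a j) (rows-linked id _ eq)))
    adj⇒parent {a , i , j} {_ , _ , j'} (inj₂ (refl , inj₂ (refl , inj₁ eq))) same w≤v =
      towards (saturated (a , i , j')) refl
      where
      w≤v′ : rowRank (saturated (a , i , j')) (toℕ j') ≤ rowRank (saturated (a , i , j)) (toℕ j)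
      w≤v′ = +-cancelˡ-≤ (toℕ i * (n + n)) _ _ w≤v
      towards : ∀ b → saturated (a , i , j') ≡ b → Parent (a , i , j) (a , i , j')
      towards true  s = let s' , ≢ = beside (valid (row i) a) eq s same in older eq s' ≢
      -- An unsaturated older neighbour has rank above that of `j`, whether or not `j` is saturated.
      towards false s = contradiction
        (subst (λ b → rowRank b (toℕ j') ≤ rowRank (saturated (a , i , j)) (toℕ j)) s w≤v′)
        (<⇒≱ (rank< (saturated (a , i , j))))
        where
        rank< : ∀ b → rowRank b (toℕ j) < n + toℕ j'
        rank< true  = ≤-<-trans (m∸n≤m n (toℕ j)) (m<m+n n (subst (0 <_) eq (s≤s z≤n)))
        rank< false = +-monoʳ-< n (≤-reflexive eq)
    adj⇒parent {a , i , j} {_ , _ , j'} (inj₂ (refl , inj₂ (refl , inj₂ eq))) same w≤v =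
      towards (saturated (a , i , j)) refl
      where
      w≤v′ : rowRank (saturated (a , i , j')) (toℕ j') ≤ rowRank (saturated (a , i , j)) (toℕ j)
      w≤v′ = +-cancelˡ-≤ (toℕ i * (n + n)) _ _ w≤v
      towards : ∀ b → saturated (a , i , j) ≡ b → Parent (a , i , j) (a , i , j')
      towards false s = newer eq s
      -- By `beside`, saturation passes to the newer neighbour `j'` of the same colour, whose rank
      -- `n ∸ j'` is then strictly larger.
      towards true  s = contradiction w≤v′ (<⇒≱ (subst₂ (λ b b' → rowRank b (toℕ j) < rowRank b' (toℕ j')) (sym s)
        (sym (proj₁ (beside (valid (row i) a) eq s (sym same)))) (∸-monoʳ-< (≤-reflexive eq) (<⇒≤ (toℕ<n j)))))

    parent-unique : ∀ {v p q} → Parent v p → Parent v q → p ≡ q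
    parent-unique (up {a} {j = j} eq _ _) (up eq' _ _) =
      cong (λ i → a , i , j) (toℕ-injective (suc-injective (trans eq (sym eq'))))
    parent-unique (older {a} {i} eq _ _) (older eq' _ _) =
      cong (λ j → a , i , j) (toℕ-injective (trans (sym eq) eq'))
    parent-unique (newer {a} {i} eq _) (newer eq' _) =
      cong (λ j → a , i , j) (toℕ-injective (suc-injective (trans eq (sym eq'))))
    parent-unique (up _ _ c≡) (older _ _ c≢) = contradiction c≡ c≢
    parent-unique (older _ _ c≢) (up _ _ c≡) = contradiction c≡ c≢
    parent-unique (up _ s _) (newer _ s') = case trans (sym s) s' of λ ()
    parent-unique (newer _ s') (up _ s _) = case trans (sym s) s' of λ ()
    parent-unique (older _ s _) (newer _ s') = case trans (sym s) s' of λ ()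
    parent-unique (newer _ s') (older _ s _) = case trans (sym s) s' of λ ()

    rainbow : ∀ v w → pos v / 2 ≡ pos w / 2 → colour v ≡ colour w → v ≡ w
    rainbow (a , i , j) (b , i' , j') eq same with combine-injective i j i' j' (toℕ-injective
      (trans (sym (half′ i j a)) (trans eq (half′ i' j' b))))
      where
      half′ : ∀ i j a → pos {m} {n} (a , i , j) / 2 ≡ toℕ (combine i j)
      half′ i j a = trans (cong (_/ 2) (toℕ-combine (combine i j) a)) (half (toℕ (combine i j)) a)
    ... | refl , refl = cong (λ a → a , i , j) (rungs (row i) j same)

  row-by-row-colouring : EquitableAcyclicLColouring (Grid m n) L
  row-by-row-colouring = record
    { c         = colour
    ; inList    = λ (a , i , j) → listed (row i) a j
    ; equitable = blocks-rainbow⇒equitable (Grid m n) 1 verts-Grid-unique pos pos< colour rainbow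
    ; acyclic   = λ x → unique-parents⇒acyclic (Grid m n) Grid-adj-sym (λ v → colour v ≡ x) rank
        λ cv cp cq vp vq p≤v q≤v → parent-unique
          (adj⇒parent vp (trans cp (sym cv)) p≤v) (adj⇒parent vq (trans cq (sym cv)) q≤v)
    }

theorem7 : (k n₂ n₃ : ℕ) → 2 ≤ n₂ → 2 ≤ n₃ → 2 ≤ k →
    EquitablyListArborable (P 2 □ P n₂ □ P n₃) k
theorem7 1 _ _ _ _ (s≤s ())
theorem7 2 _ _ _ _ _ L = RowByRow.row-by-row-colouring L
theorem7 (suc (suc (suc κ))) (suc _) (suc n) _ _ _ L = Greedy.greedy-colouring (suc n) κ L
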